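{- Let $n \ge 4$ and let $f : [1,\infty) \to \mathbb{R}$ be a concave function. Then for every unicyclic graph $G$ with $n$ vertices, $$ f(n-1) + 2 f(2) + (n-3) f(1) \le I_f(G) \le n f(2), $$ and both inequalities are attained (i.e., for each such $n$ and $f$, each of the two bounds is equal to $I_f(G)$ for some unicyclic graph $G$ with $n$ vertices).
   Context: All graphs are finite, connected, simple (no loops, no multiple edges) and have at least one edge. A unicyclic graph is a graph containing exactly one cycle. For a vertex $u$ of $G$, $d_u$ denotes its degree. For a function $f:[1,\infty)\to\mathbb{R}$, $I_f(G) = \sum_{u\in V(G)} f(d_u)$. -}

module Defs where

open import Algebra.Apartness.Bundles
  using (HeytingField; module HeytingCommutativeRing)
open import Algebra.Bundles using (CommutativeRing)
import Algebra.Apartness.Properties.HeytingCommutativeRing as HeytingProperties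
import Algebra.Definitions.RawMonoid as RawMonoidDefinitions
import Algebra.Properties.CommutativeMonoid.Sum as SumProperties
import Algebra.Properties.Ring as RingProperties
open import Data.Fin.Base using (Fin)
open import Data.List.Base using (List; []; _∷_; _++_; _∷ʳ_; length; filter; allFin)
open import Data.List.Membership.Propositional using (lose)
open import Data.List.Membership.Propositional.Properties using (∈-allFin)
open import Data.List.Properties using (filter-some)
open import Data.List.Relation.Unary.Linked using (Linked)
open import Data.List.Relation.Unary.Unique.Propositional using (Unique)
open import Data.Nat.Base as ℕ using (ℕ; zero; suc; _∸_; NonZero; s≤s)
open import Data.Product.Base using (Σ; ∃; ∃₂; _×_; _,_; proj₁; proj₂)
open import Data.Sum.Base using (_⊎_; inj₁; inj₂; [_,_]′)
open import Function.Base using (_∘_)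
open import Function.Bundles using (_⇔_; Func; module Equivalence)
open import Level using (Level; 0ℓ; _⊔_) renaming (suc to lsuc)
open import Relation.Binary.Bundles using (Setoid)
open import Relation.Binary.Core using (Rel)
open import Relation.Binary.Construct.Closure.ReflexiveTransitive using (Star; ε; _◅_)
import Relation.Binary.Construct.On as On
open import Relation.Binary.Definitions using (Symmetric; Irreflexive; Decidable)
open import Relation.Binary.PropositionalEquality.Core using (_≡_)
open import Relation.Binary.Structures using (IsStrictPartialOrder)
open import Relation.Nullary.Negation using (¬_; contradiction)

-- The real numbers, axiomatised as a Cauchy-complete Archimedean ordered
-- field.  Classically these axioms determine ℝ up to unique isomorphism.
-- The order is not assumed decidable, so the constructive reals are also
-- a model.

record RealNumbers (c ℓ₁ ℓ₂ : Level) : Set (lsuc (c ⊔ ℓ₁ ⊔ ℓ₂)) where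
  infix 4 _<_ _≤_
  field
    heytingField : HeytingField c ℓ₁ ℓ₂

  open HeytingField heytingField public

  commutativeRing : CommutativeRing c ℓ₁
  commutativeRing = HeytingCommutativeRing.commutativeRing heytingCommutativeRing

  open CommutativeRing commutativeRing public
    using (ring; +-rawMonoid; +-commutativeMonoid)

  field
    _<_                  : Rel Carrier ℓ₂
    isStrictPartialOrder : IsStrictPartialOrder _≈_ _<_
    #⇔<⊎>                : ∀ {x y} → x # y ⇔ (x < y ⊎ y < x)
    +-monoˡ-<            : ∀ {x y} z → x < y → x + z < y + z
    *-pos                : ∀ {x y} → 0# < x → 0# < y → 0# < x * y

  open IsStrictPartialOrder isStrictPartialOrder public
    using (<-respʳ-≈; <-respˡ-≈)
    renaming ( irrefl to <-irrefl; trans to <-trans; asym to <-asym )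

  _≤_ : Rel Carrier ℓ₂
  x ≤ y = ¬ (y < x)

  ι : ℕ → Carrier
  ι k = RawMonoidDefinitions._×_ +-rawMonoid k 1#

  -- |x m - x k| < δ and |x k - a| < δ, each split into two one-sided bounds.

  IsCauchy : (ℕ → Carrier) → Set (c ⊔ ℓ₂)
  IsCauchy x = ∀ δ → 0# < δ → ∃ λ N → ∀ m k → N ℕ.≤ m → N ℕ.≤ k →
    x m < x k + δ × x k < x m + δ

  ConvergesTo : (ℕ → Carrier) → Carrier → Set (c ⊔ ℓ₂)
  ConvergesTo x a = ∀ δ → 0# < δ → ∃ λ N → ∀ k → N ℕ.≤ k →
    x k < a + δ × a < x k + δ

  field
    archimedean : ∀ x → ∃ λ k → x < ι k
    complete    : ∀ x → IsCauchy x → ∃ (ConvergesTo x)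

module OrderProperties {c ℓ₁ ℓ₂} (ℝ : RealNumbers c ℓ₁ ℓ₂) where
  open RealNumbers ℝ
  open HeytingProperties heytingCommutativeRing using (1#0; x-0≈x; invertibleˡ⇒#)
  open RingProperties ring using (-‿distribˡ-*; -‿distribʳ-*; -‿involutive)
  open import Relation.Binary.Reasoning.Setoid setoid

  private
    variable
      x y z w : Carrier

  cotrans : x < y → ∀ z → x < z ⊎ z < y
  cotrans x<y z with #-cotrans (Equivalence.from #⇔<⊎> (inj₁ x<y)) z
  ... | inj₁ x#z = [ inj₁ , (λ z<x → inj₂ (<-trans z<x x<y)) ]′ (Equivalence.to #⇔<⊎> x#z)
  ... | inj₂ z#y = [ inj₂ , (λ y<z → inj₁ (<-trans x<y y<z)) ]′ (Equivalence.to #⇔<⊎> z#y)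

  ≤-refl : x ≤ x
  ≤-refl = <-irrefl refl

  ≤-trans : x ≤ y → y ≤ z → x ≤ z
  ≤-trans {y = y} x≤y y≤z z<x = [ y≤z , x≤y ]′ (cotrans z<x y)

  <⇒≤ : x < y → x ≤ y
  <⇒≤ x<y y<x = <-asym x<y y<x

  ≤-respʳ-≈ : y ≈ z → x ≤ y → x ≤ z
  ≤-respʳ-≈ y≈z x≤y z<x = x≤y (<-respˡ-≈ (sym y≈z) z<x)

  ≤-respˡ-≈ : x ≈ z → x ≤ y → z ≤ y
  ≤-respˡ-≈ x≈z x≤y y<z = x≤y (<-respʳ-≈ (sym x≈z) y<z)

  private
    x+z-z≈x : ∀ x z → x + z + - z ≈ x
    x+z-z≈x x z = trans (+-assoc x z (- z)) (trans (+-congˡ (-‿inverseʳ z)) (+-identityʳ x))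

  +-monoˡ-≤ : ∀ z → x ≤ y → x + z ≤ y + z
  +-monoˡ-≤ {x} {y} z x≤y y+z<x+z =
    x≤y (<-respˡ-≈ (x+z-z≈x y z) (<-respʳ-≈ (x+z-z≈x x z) (+-monoˡ-< (- z) y+z<x+z)))

  +-mono-≤ : x ≤ y → z ≤ w → x + z ≤ y + w
  +-mono-≤ {x} {y} {z} {w} x≤y z≤w = ≤-trans (+-monoˡ-≤ z x≤y)
    (≤-respˡ-≈ (+-comm z y) (≤-respʳ-≈ (+-comm w y) (+-monoˡ-≤ y z≤w)))

  x≤y⇒0≤y-x : x ≤ y → 0# ≤ y - x
  x≤y⇒0≤y-x {x} x≤y = ≤-respˡ-≈ (-‿inverseʳ x) (+-monoˡ-≤ (- x) x≤y)

  0<1 : 0# < 1#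
  0<1 with Equivalence.to #⇔<⊎> 1#0
  ... | inj₂ 0<1 = 0<1
  ... | inj₁ 1<0 = <-respʳ-≈ -1*-1≈1 (*-pos 0<-1 0<-1)
    where
    0<-1 : 0# < - 1#
    0<-1 = <-respˡ-≈ (-‿inverseʳ 1#) (<-respʳ-≈ (+-identityˡ (- 1#)) (+-monoˡ-< (- 1#) 1<0))
    -1*-1≈1 : - 1# * - 1# ≈ 1#
    -1*-1≈1 = begin
      - 1# * - 1#    ≈⟨ -‿distribˡ-* 1# (- 1#) ⟨
      - (1# * - 1#)  ≈⟨ -‿cong (*-identityˡ (- 1#)) ⟩
      - - 1#         ≈⟨ -‿involutive 1# ⟩
      1#             ∎

  *-nonNeg : 0# ≤ x → 0# ≤ y → 0# ≤ x * y
  *-nonNeg {x} {y} 0≤x 0≤y xy<0 with #⇒invertible (Equivalence.from #⇔<⊎> (inj₁ xy<0))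
  ... | (i , i*[xy-0]≈1 , _) = <-asym xy<0 (*-pos (pos 0≤x x#0) (pos 0≤y y#0))
    where
    i*xy≈1 : i * (x * y) ≈ 1#
    i*xy≈1 = trans (*-congˡ (sym (x-0≈x (x * y)))) i*[xy-0]≈1
    pos : ∀ {a} → 0# ≤ a → a # 0# → 0# < a
    pos 0≤a a#0 = [ (λ a<0 → contradiction a<0 0≤a) , (λ 0<a → 0<a) ]′ (Equivalence.to #⇔<⊎> a#0)
    y#0 : y # 0#
    y#0 = invertibleˡ⇒# (i * x , (begin
      i * x * (y - 0#)  ≈⟨ *-congˡ (x-0≈x y) ⟩
      i * x * y         ≈⟨ *-assoc i x y ⟩
      i * (x * y)       ≈⟨ i*xy≈1 ⟩
      1#                ∎))
    x#0 : x # 0#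
    x#0 = invertibleˡ⇒# (i * y , (begin
      i * y * (x - 0#)  ≈⟨ *-congˡ (x-0≈x x) ⟩
      i * y * x         ≈⟨ *-assoc i y x ⟩
      i * (y * x)       ≈⟨ *-congˡ (*-comm y x) ⟩
      i * (x * y)       ≈⟨ i*xy≈1 ⟩
      1#                ∎))

  *-monoʳ-≤-nonNeg : 0# ≤ z → x ≤ y → z * x ≤ z * y
  *-monoʳ-≤-nonNeg {z} {x} {y} 0≤z x≤y =
    ≤-respˡ-≈ (+-identityˡ (z * x)) (≤-respʳ-≈ eq
      (+-monoˡ-≤ (z * x) (*-nonNeg 0≤z (x≤y⇒0≤y-x x≤y))))
    where
    eq : z * (y - x) + z * x ≈ z * y
    eq = begin
      z * (y - x) + z * x    ≈⟨ distribˡ z (y - x) x ⟨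
      z * (y + - x + x)      ≈⟨ *-congˡ (+-assoc y (- x) x) ⟩
      z * (y + (- x + x))    ≈⟨ *-congˡ (+-congˡ (-‿inverseˡ x)) ⟩
      z * (y + 0#)           ≈⟨ *-congˡ (+-identityʳ y) ⟩
      z * y                  ∎

  0≤ι : ∀ k → 0# ≤ ι k
  0≤ι zero    = ≤-refl
  0≤ι (suc k) = ≤-respˡ-≈ (+-identityˡ 0#) (+-mono-≤ (<⇒≤ 0<1) (0≤ι k))

  1≤ι : ∀ k .{{_ : NonZero k}} → 1# ≤ ι k
  1≤ι (suc k) = ≤-respˡ-≈ (+-identityʳ 1#) (+-mono-≤ ≤-refl (0≤ι k))

  1≤convex : ∀ t → 0# ≤ t → t ≤ 1# → 1# ≤ x → 1# ≤ y → 1# ≤ t * x + (1# - t) * y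
  1≤convex t 0≤t t≤1 1≤x 1≤y = ≤-respˡ-≈ eq
    (+-mono-≤ (*-monoʳ-≤-nonNeg 0≤t 1≤x) (*-monoʳ-≤-nonNeg (x≤y⇒0≤y-x t≤1) 1≤y))
    where
    eq : t * 1# + (1# - t) * 1# ≈ 1#
    eq = begin
      t * 1# + (1# - t) * 1#  ≈⟨ +-cong (*-identityʳ t) (*-identityʳ (1# - t)) ⟩
      t + (1# - t)            ≈⟨ +-comm t (1# - t) ⟩
      1# + - t + t            ≈⟨ +-assoc 1# (- t) t ⟩
      1# + (- t + t)          ≈⟨ +-congˡ (-‿inverseˡ t) ⟩
      1# + 0#                 ≈⟨ +-identityʳ 1# ⟩
      1#                      ∎

-- Graphs on the vertex set Fin n.

record Graph (n : ℕ) : Set₁ where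
  infix 4 _~_ _~?_
  field
    _~_       : Rel (Fin n) 0ℓ
    _~?_      : Decidable _~_
    ~-sym     : Symmetric _~_
    ~-irrefl  : Irreflexive _≡_ _~_
    connected : ∀ u v → Star _~_ u v
    hasEdge   : ∃₂ _~_

  degree : Fin n → ℕ
  degree u = length (filter (u ~?_) (allFin n))

  degree-nonZero : ∀ u → NonZero (degree u)
  degree-nonZero u = ℕ.>-nonZero
    (filter-some (u ~?_) (lose (∈-allFin (proj₁ neighbour)) (proj₂ neighbour)))
    where
    neighbour : ∃ (u ~_)
    neighbour with connected u (proj₁ hasEdge)
    ... | ε       = proj₂ hasEdge
    ... | u~w ◅ _ = _ , u~w

  -- The cycle base, rest₁, …, restₘ, base.  Requiring m ≥ 2 leaves at
  -- least three distinct vertices.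

  record Cycle : Set where
    field
      base     : Fin n
      rest     : List (Fin n)
      long     : 2 ℕ.≤ length rest
      distinct : Unique (base ∷ rest)
      linked   : Linked _~_ (base ∷ rest ∷ʳ base)

  Consecutive : List (Fin n) → Rel (Fin n) 0ℓ
  Consecutive ws u v = ∃₂ λ as bs → ws ≡ as ++ u ∷ v ∷ bs

  CycleEdge : Cycle → Rel (Fin n) 0ℓ
  CycleEdge C u v = Consecutive walk u v ⊎ Consecutive walk v u
    where
    open Cycle C
    walk : List (Fin n)
    walk = base ∷ rest ∷ʳ base

  -- A cycle is a subgraph: its starting point and orientation are
  -- immaterial, and it is determined by its edges.

  SameCycle : Rel Cycle 0ℓ
  SameCycle C D = ∀ u v → CycleEdge C u v ⇔ CycleEdge D u v

Unicyclic : ∀ {n} → Graph n → Set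
Unicyclic G = ∃ λ C → ∀ D → SameCycle C D
  where open Graph G

module Indices {c ℓ₁ ℓ₂} (ℝ : RealNumbers c ℓ₁ ℓ₂) where
  open RealNumbers ℝ
  open OrderProperties ℝ using (1≤ι; 1≤convex)
  open SumProperties +-commutativeMonoid using (sum)

  -- The interval [1,∞).

  Ray : Setoid (c ⊔ ℓ₂) ℓ₁
  Ray = On.setoid setoid (proj₁ {B = 1# ≤_})

  Ray→ℝ : Set (c ⊔ ℓ₁ ⊔ ℓ₂)
  Ray→ℝ = Func Ray setoid

  convex : ∀ t → 0# ≤ t → t ≤ 1# → Setoid.Carrier Ray → Setoid.Carrier Ray → Setoid.Carrier Ray
  convex t 0≤t t≤1 (x , 1≤x) (y , 1≤y) =
    t * x + (1# - t) * y , 1≤convex t 0≤t t≤1 1≤x 1≤y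

  Concave : Ray→ℝ → Set (c ⊔ ℓ₂)
  Concave f = ∀ x y t (0≤t : 0# ≤ t) (t≤1 : t ≤ 1#) →
    t * to x + (1# - t) * to y ≤ to (convex t 0≤t t≤1 x y)
    where open Func f

  infix 8 _at_
  _at_ : Ray→ℝ → (k : ℕ) .{{_ : NonZero k}} → Carrier
  f at k = Func.to f (ι k , 1≤ι k)

  I : ∀ {n} → Ray→ℝ → Graph n → Carrier
  I f G = sum λ u → _at_ f (degree u) {{degree-nonZero u}}
    where open Graph G

4≤n⇒n∸1-nonZero : ∀ {n} → 4 ℕ.≤ n → NonZero (n ∸ 1)
4≤n⇒n∸1-nonZero (s≤s (s≤s _)) = _

{-# OPTIONS --safe #-}

-- Deleting an edge {a , x} of the cycle leaves a connected graph, and every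
-- remaining edge lies on a fixed spanning tree rooted at a, since otherwise it
-- would close a second cycle, one avoiding {a , x}.  Directing the tree edges
-- towards a and a towards x gives each vertex out-degree 1, so that a degree is
-- 1 + (in-degree) and the in-degrees sum to n.  With F k = f (1 + k), the upper
-- bound sums the inequality of F with its chord through 0 and 1 over the
-- in-degrees.  For the lower bound, three cycle vertices have in-degree at
-- least 1; by concavity the remaining n − 3 units contribute least when they
-- are all gathered at one of these three.

module Submission where

open import Defs
open import Algebra.Bundles using (module CommutativeRing)
import Algebra.Apartness.Properties.HeytingCommutativeRing as HeytingProperties
import Algebra.Properties.CommutativeMonoid.Sum as SumProperties
import Algebra.Properties.Monoid.Mult as MultProperties
import Algebra.Properties.Semiring.Mult as SemiringMultProperties
import Algebra.Solver.CommutativeMonoid as CommutativeMonoidSolver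
open import Data.Bool.Base using (if_then_else_)
open import Data.Fin.Base using (Fin; zero; suc; toℕ; fromℕ; inject₁)
open import Data.Fin.Induction using (<-weakInduction)
open import Data.Fin.Patterns using (0F; 1F; 2F)
import Data.Fin.Properties as Fin
open import Data.Fin.Relation.Unary.Top using (view; ‵fromℕ; ‵inject₁)
open import Data.List.Base as List using (List; []; _∷_; _∷ʳ_; length; filter)
open import Data.List.Membership.Propositional using (_∈_; _∉_)
open import Data.List.Membership.Propositional.Properties using (∈-++⁻; ∈-++⁺ʳ)
open import Data.List.Properties using (∷-injectiveʳ)
open import Data.List.Relation.Unary.All as All using (All; []; _∷_)
import Data.List.Relation.Unary.All.Properties as All
open import Data.List.Relation.Unary.AllPairs using ([]; _∷_)
open import Data.List.Relation.Unary.Any using (here; there)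
open import Data.List.Relation.Unary.Linked as Linked using (Linked; [-]; _∷_)
open import Data.List.Relation.Unary.Unique.Propositional using (Unique)
open import Data.List.Relation.Unary.Unique.Propositional.Properties using (Unique[x∷xs]⇒x∉xs; allFin⁺)
open import Data.Nat.Base as ℕ using (ℕ; zero; suc; _∸_; NonZero; z≤n; s≤s)
open import Data.Nat.Induction using (<-rec)
import Data.Nat.Properties as ℕ
open import Data.Product.Base as Prod using (∃; ∃₂; _×_; Σ-syntax; _,_; proj₁; proj₂)
open import Data.Sum.Base as Sum using (_⊎_; inj₁; inj₂; [_,_]′)
open import Function.Base using (_∘_; id; flip)
open import Function.Bundles using (Func; mk⇔; module Equivalence)
open import Level using (Level; 0ℓ; _⊔_)
open import Relation.Binary.Construct.Closure.ReflexiveTransitive as Star using (Star; ε; _◅_; _◅◅_)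
open import Relation.Binary.Core using (Rel)
open import Relation.Binary.Definitions using (Symmetric; Decidable)
open import Relation.Binary.PropositionalEquality as ≡ using (_≡_; _≢_; refl; sym; trans; cong; cong₂; subst)
open import Relation.Nullary.Decidable
  using (Dec; yes; no; does; _×-dec_; _⊎-dec_; ¬?; decidable-stable; does-⇔)
open import Relation.Nullary.Negation using (¬_; contradiction)
import Relation.Unary as Unary

open SumProperties ℕ.+-0-commutativeMonoid using (sum; sum-cong-≗; sum-remove; ∑-distrib-+; ∑-comm)

private
  variable
    a p q r : Level
    A : Set a
    n : ℕ

-- Sums of indicators over finite sets.

indicator : {P : Set p} → Dec P → ℕ
indicator P? = if does P? then 1 else 0

indicator-yes : {P : Set p} (P? : Dec P) → P → indicator P? ≡ 1
indicator-yes (yes _) _ = refl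
indicator-yes (no ¬P) P = contradiction P ¬P

-- The four hypotheses make `P` the disjoint union of `Q` and `R`; this splits the neighbours of a
-- vertex into out-neighbours and in-neighbours.
indicator-⊎ : {P : Set p} {Q : Set q} {R : Set r} (P? : Dec P) (Q? : Dec Q) (R? : Dec R) →
              (P → Q ⊎ R) → (Q → P) → (R → P) → (Q → ¬ R) →
              indicator P? ≡ indicator Q? ℕ.+ indicator R?
indicator-⊎ (yes _) (yes Q) (yes R) f g h k = contradiction R (k Q)
indicator-⊎ (yes _) (yes _) (no _)  f g h k = refl
indicator-⊎ (yes _) (no _)  (yes _) f g h k = refl
indicator-⊎ (yes P) (no ¬Q) (no ¬R) f g h k = contradiction (f P) [ ¬Q , ¬R ]′
indicator-⊎ (no ¬P) (yes Q) _       f g h k = contradiction (g Q) ¬P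
indicator-⊎ (no ¬P) (no _)  (yes R) f g h k = contradiction (h R) ¬P
indicator-⊎ (no _)  (no _)  (no _)  f g h k = refl

sum-0 : ∀ n → sum {n} (λ _ → 0) ≡ 0
sum-0 zero    = refl
sum-0 (suc n) = sum-0 n

sum-1 : ∀ n → sum {n} (λ _ → 1) ≡ n
sum-1 zero    = refl
sum-1 (suc n) = cong suc (sum-1 n)

sum-indicator-≟ : (u : Fin n) → sum (λ v → indicator (v Fin.≟ u)) ≡ 1
sum-indicator-≟ {suc n} zero    = cong suc (sum-0 n)
sum-indicator-≟ {suc n} (suc u) = sum-indicator-≟ u

lookup≤sum : (t : Fin n → ℕ) (i : Fin n) → t i ℕ.≤ sum t
lookup≤sum {suc n} t i = subst (t i ℕ.≤_) (sym (sum-remove {i = i} t)) (ℕ.m≤m+n (t i) _)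

length-filter-tabulate : {P : A → Set p} (P? : Unary.Decidable P) (g : Fin n → A) →
  length (filter P? (List.tabulate g)) ≡ sum (indicator ∘ P? ∘ g)
length-filter-tabulate {n = zero}  P? g = refl
length-filter-tabulate {n = suc n} P? g with P? (g zero)
... | yes _ = cong suc (length-filter-tabulate P? (g ∘ suc))
... | no _  = length-filter-tabulate P? (g ∘ suc)

-- In-degrees and orientations.

indegree : (Fin n → Fin n) → Fin n → ℕ
indegree h u = sum (λ v → indicator (u Fin.≟ h v))

-- Double counting: after the sums are exchanged, each `v` is counted once, at `u = h v`.
sum-indegree : (h : Fin n → Fin n) → sum (indegree h) ≡ n
sum-indegree {n} h = trans (∑-comm (λ u v → indicator (u Fin.≟ h v)))
  (trans (sum-cong-≗ (λ v → sum-indicator-≟ (h v))) (sum-1 n))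

-- An orientation with out-degree 1 everywhere; next∘next≢id says that no edge
-- is directed both ways.

record Orientation (G : Graph n) : Set where
  open Graph G
  field
    next         : Fin n → Fin n
    ~-next       : ∀ u → u ~ next u
    ~⇒next       : ∀ {u v} → u ~ v → v ≡ next u ⊎ u ≡ next v
    next∘next≢id : ∀ u → next (next u) ≢ u

  -- The neighbours of `u` are `next u` and the preimages of `u` under `next`; `next∘next≢id` keeps
  -- the two kinds disjoint.
  degree≡1+indegree : ∀ u → degree u ≡ suc (indegree next u)
  degree≡1+indegree u = begin
    degree u
      ≡⟨ length-filter-tabulate (u ~?_) id ⟩
    sum (λ v → indicator (u ~? v))
      ≡⟨ sum-cong-≗ (λ v → indicator-⊎ (u ~? v) (v Fin.≟ next u) (u Fin.≟ next v)
           ~⇒next (λ { refl → ~-next u }) (λ { refl → ~-sym (~-next v) })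
           (λ { refl u≡next∘next → next∘next≢id u (sym u≡next∘next) })) ⟩
    sum (λ v → indicator (v Fin.≟ next u) ℕ.+ indicator (u Fin.≟ next v))
      ≡⟨ ∑-distrib-+ (λ v → indicator (v Fin.≟ next u)) (λ v → indicator (u Fin.≟ next v)) ⟩
    sum (λ v → indicator (v Fin.≟ next u)) ℕ.+ indegree next u
      ≡⟨ cong (ℕ._+ indegree next u) (sum-indicator-≟ (next u)) ⟩
    suc (indegree next u) ∎
    where open ≡.≡-Reasoning

  -- Of two distinct neighbours at most one is `next u`, so the edge to the other is directed
  -- towards `u`.
  1≤indegree : ∀ {u v w} → v ≢ w → u ~ v → u ~ w → 1 ℕ.≤ indegree next u
  1≤indegree {u} v≢w u~v u~w with ~⇒next u~v | ~⇒next u~w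
  ... | inj₁ v≡nu | inj₁ w≡nu = contradiction (trans v≡nu (sym w≡nu)) v≢w
  ... | inj₂ u≡nv | _         = subst (ℕ._≤ indegree next u) (indicator-yes (u Fin.≟ _) u≡nv)
                                  (lookup≤sum (λ v → indicator (u Fin.≟ next v)) _)
  ... | inj₁ _    | inj₂ u≡nw = subst (ℕ._≤ indegree next u) (indicator-yes (u Fin.≟ _) u≡nw)
                                  (lookup≤sum (λ v → indicator (u Fin.≟ next v)) _)

-- Breadth-first distances and parents.

least : {P : ℕ → Set p} → Unary.Decidable P → ∀ k → P k →
        ∃ λ m → P m × (∀ j → P j → m ℕ.≤ j)
least P? k Pk with P? 0
... | yes P0 = 0 , P0 , λ _ _ → z≤n
least P? zero    Pk | no ¬P0 = contradiction Pk ¬P0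
least P? (suc k) Pk | no ¬P0 with least (P? ∘ suc) k Pk
... | m , Pm , m≤ = suc m , Pm , λ { zero P0 → contradiction P0 ¬P0 ; (suc j) Pj → s≤s (m≤ j Pj) }

module BreadthFirst {R : Rel (Fin n) 0ℓ} (R? : Decidable R)
                    (root : Fin n) (toRoot : ∀ u → Star R u root) where

  -- The walk has exactly `k` steps, not at most `k`; the least such `k` is the distance all the
  -- same.
  Within : ℕ → Fin n → Set
  Within zero    u = u ≡ root
  Within (suc k) u = ∃ λ v → R u v × Within k v

  within? : ∀ u k → Dec (Within k u)
  within? u zero    = u Fin.≟ root
  within? u (suc k) = Fin.any? (λ v → R? u v ×-dec within? v k)

  star⇒within : ∀ {u} → Star R u root → ∃ λ k → Within k u
  star⇒within ε          = 0 , refl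
  star⇒within (Ruv ◅ vs) with star⇒within vs
  ... | k , w = suc k , _ , Ruv , w

  nearest : ∀ u → ∃ λ m → Within m u × (∀ j → Within j u → m ℕ.≤ j)
  nearest u with star⇒within (toRoot u)
  ... | k , w = least (within? u) k w

  -- Opaque, so that with-abstractions of u ≟ root do not reach inside the search.
  opaque
    distance : Fin n → ℕ
    distance = proj₁ ∘ nearest

    nearer : ∀ u → u ≢ root → ∃ λ v → R u v × distance v ℕ.< distance u
    nearer u u≢root with nearest u
    ... | zero  , u≡root , _        = contradiction u≡root u≢root
    -- The second vertex `v` of a shortest walk reaches the root in `m` steps, so minimality at `v`
    -- bounds `distance v` by `m`.
    ... | suc m , (v , Ruv , w) , _ = v , Ruv , s≤s (proj₂ (proj₂ (nearest v)) m w)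

  opaque
    -- The root has no parent and gets the value `x`. In the use below, `x` is the other end of the
    -- deleted edge, which is thereby directed out of the root.
    parent : ∀ x u → ∃ λ v → (u ≡ root → v ≡ x) × (u ≢ root → R u v × distance v ℕ.< distance u)
    parent x u with u Fin.≟ root
    ... | yes u≡root = x , (λ _ → refl) , contradiction u≡root
    ... | no  u≢root with nearer u u≢root
    ...   | v , closer = v , flip contradiction u≢root , λ _ → closer

-- Simple paths.

-- The list omits the starting vertex.

data Path {A : Set a} (T : Rel A r) : A → A → List A → Set (a ⊔ r) where
  []  : ∀ {x} → Path T x x []
  _∷_ : ∀ {x y z xs} → T x y × x ∉ y ∷ xs → Path T y z xs → Path T x z (y ∷ xs)

module _ {T : Rel (Fin n) r} where
  open import Data.List.Membership.DecPropositional (Fin._≟_ {n}) using (_∈?_)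

  path-suffix : ∀ {x y z xs} → Path T y z xs → x ∈ y ∷ xs → ∃ (Path T x z)
  path-suffix p       (here refl) = _ , p
  path-suffix (_ ∷ p) (there x∈)  = path-suffix p x∈

  -- Loop erasure: if the starting vertex recurs on the path, only the suffix from that recurrence
  -- is kept.
  star⇒path : ∀ {x z} → Star T x z → ∃ (Path T x z)
  star⇒path ε = _ , []
  star⇒path {x} (_◅_ {j = y} Txy y⋯z) with star⇒path y⋯z
  ... | xs , p with x ∈? y ∷ xs
  ...   | yes x∈ = path-suffix p x∈
  ...   | no  x∉ = _ , (Txy , x∉) ∷ p

path-unique : ∀ {T : Rel A r} {x y xs} → Path T x y xs → Unique (x ∷ xs)
path-unique []              = [] ∷ []
path-unique ((_ , x∉) ∷ p)  = All.¬Any⇒All¬ _ x∉ ∷ path-unique p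

path-linked : ∀ {T R : Rel A r} {x y z xs} → (∀ {u v} → T u v → R u v) →
              Path T x y xs → R y z → Linked R (x ∷ xs ∷ʳ z)
path-linked T⇒R []              Ryz = Ryz ∷ [-]
path-linked T⇒R ((Txy , _) ∷ p) Ryz = T⇒R Txy ∷ path-linked T⇒R p Ryz

-- Cycles and their edges.

module _ (G : Graph n) where
  open Graph G

  consecutive-here : ∀ {u v ws} → Consecutive (u ∷ v ∷ ws) u v
  consecutive-here = [] , _ , refl

  consecutive-there : ∀ {u v w ws} → Consecutive ws u v → Consecutive (w ∷ ws) u v
  consecutive-there (as , bs , eq) = _ ∷ as , bs , cong (_ ∷_) eq

  linked-consecutive : ∀ {R : Rel (Fin n) r} {ws u v} → Linked R ws → Consecutive ws u v → R u v
  linked-consecutive (Ruv ∷ _) ([]         , _ , refl) = Ruv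
  linked-consecutive [-]       (_ ∷ []     , _ , ())
  linked-consecutive [-]       (_ ∷ _ ∷ _  , _ , ())
  linked-consecutive (_ ∷ l)   (_ ∷ as , bs , eq) =
    linked-consecutive l (as , bs , ∷-injectiveʳ eq)

  -- Symmetry of `R` absorbs the immaterial direction of a cycle edge. With `R` the edges left after
  -- a deletion, the cycle cannot use the deleted edge.
  cycleEdge-linked : ∀ {R : Rel (Fin n) r} → Symmetric R → ∀ C →
    let open Cycle C in Linked R (base ∷ rest ∷ʳ base) → ∀ {u v} → CycleEdge C u v → R u v
  cycleEdge-linked R-sym C l (inj₁ uv) = linked-consecutive l uv
  cycleEdge-linked R-sym C l (inj₂ vu) = R-sym (linked-consecutive l vu)

  cycleEdge⇒~ : ∀ C {u v} → CycleEdge C u v → u ~ v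
  cycleEdge⇒~ C = cycleEdge-linked ~-sym C (Cycle.linked C)

  cycleEdge-sym : ∀ C {u v} → CycleEdge C u v → CycleEdge C v u
  cycleEdge-sym C = Sum.swap

  CycleVertex : Cycle → Fin n → Set
  CycleVertex C u = u ∈ base ∷ rest
    where open Cycle C

  cycleEdge⇒vertex : ∀ C {u v} → CycleEdge C u v → CycleVertex C u
  cycleEdge⇒vertex C {u} {v} = [ on-walk ∘ first , on-walk ∘ second ]′
    where
    open Cycle C
    on-walk : u ∈ base ∷ rest ∷ʳ base → CycleVertex C u
    on-walk u∈ with ∈-++⁻ (base ∷ rest) u∈
    ... | inj₁ u∈′         = u∈′
    ... | inj₂ (here refl) = here refl
    first : ∀ {ws} → Consecutive ws u v → u ∈ ws
    first (as , bs , refl) = ∈-++⁺ʳ as (here refl)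
    second : ∀ {ws} → Consecutive ws v u → u ∈ ws
    second (as , bs , refl) = ∈-++⁺ʳ as (there (here refl))

  consecutive-last : ∀ w ws z → ∃ λ l → l ∈ w ∷ ws × Consecutive (w ∷ ws ∷ʳ z) l z
  consecutive-last w []       z = w , here refl , consecutive-here
  consecutive-last w (v ∷ ws) z with consecutive-last v ws z
  ... | l , l∈ , lz = l , there l∈ , consecutive-there lz

  -- p ≡ z is harmful only if ws is a singleton, whose two neighbours are p and z.
  consecutive-inner : ∀ {p z u} ws → Unique (p ∷ ws) → z ∉ ws → p ≢ z ⊎ 2 ℕ.≤ length ws → u ∈ ws →
    ∃₂ λ v w → v ≢ w × Consecutive (p ∷ ws ∷ʳ z) v u × Consecutive (p ∷ ws ∷ʳ z) u w
  consecutive-inner (_ ∷ [])    _ z∉ (inj₁ p≢z) (here refl) =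
    _ , _ , p≢z , consecutive-here , consecutive-there consecutive-here
  consecutive-inner (_ ∷ [])    _ z∉ (inj₂ (s≤s ())) _
  consecutive-inner (_ ∷ _ ∷ _) ((_ ∷ p≢w ∷ _) ∷ _) z∉ _ (here refl) =
    _ , _ , p≢w , consecutive-here , consecutive-there consecutive-here
  consecutive-inner (w ∷ ws) (_ ∷ unique) z∉ _ (there u∈)
    with consecutive-inner ws unique (z∉ ∘ there) (inj₁ (λ { refl → z∉ (here refl) })) u∈
  ... | v , w , v≢w , vu , uw = v , w , v≢w , consecutive-there vu , consecutive-there uw

  -- A vertex of `rest` has its predecessor and successor on the closed walk; `base` has the first
  -- and last entries of `rest`, which differ since `rest` has at least two distinct entries.
  two-cycleEdges : ∀ C {u} → CycleVertex C u →
                   ∃₂ λ v w → v ≢ w × CycleEdge C u v × CycleEdge C u w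
  two-cycleEdges record { base = b ; rest = ws ; long = long ; distinct = distinct } (there u∈)
    with consecutive-inner ws distinct (Unique[x∷xs]⇒x∉xs distinct) (inj₂ long) u∈
  ... | v , w , v≢w , vu , uw = v , w , v≢w , inj₂ vu , inj₁ uw
  two-cycleEdges record { rest = _ ∷ [] ; long = s≤s () } (here refl)
  two-cycleEdges record { base = b ; rest = x ∷ y ∷ ws ; distinct = _ ∷ distinct } (here refl)
    with consecutive-last y ws b
  ... | l , l∈ , lb = x , l , (λ { refl → Unique[x∷xs]⇒x∉xs distinct l∈ })
                    , inj₁ consecutive-here , inj₂ (consecutive-there (consecutive-there lb))

-- Deleting a cycle edge and orienting the graph.

module Deletion (G : Graph n) (a x : Fin n) where
  open Graph G

  Deleted : Rel (Fin n) 0ℓ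
  Deleted u v = u ≡ a × v ≡ x ⊎ u ≡ x × v ≡ a

  deleted? : Decidable Deleted
  deleted? u v = ((u Fin.≟ a) ×-dec (v Fin.≟ x)) ⊎-dec ((u Fin.≟ x) ×-dec (v Fin.≟ a))

  Remaining : Rel (Fin n) 0ℓ
  Remaining u v = u ~ v × ¬ Deleted u v

  remaining? : Decidable Remaining
  remaining? u v = (u ~? v) ×-dec ¬? (deleted? u v)

  remaining-sym : Symmetric Remaining
  remaining-sym (u~v , ¬ax) = ~-sym u~v , ¬ax ∘ Sum.swap ∘ Sum.map Prod.swap Prod.swap

  remaining-or-deleted : ∀ {u v} → u ~ v → Remaining u v ⊎ Deleted u v
  remaining-or-deleted {u} {v} u~v with deleted? u v
  ... | yes ax = inj₂ ax
  ... | no ¬ax = inj₁ (u~v , ¬ax)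

  avoiding : ∀ {u v} → u ≢ a → u ≢ x → u ~ v → Remaining u v
  avoiding u≢a u≢x u~v = u~v , [ u≢a ∘ proj₁ , u≢x ∘ proj₁ ]′

  -- An edge leaving a vertex other than `a` and `x` is not deleted, so an arc of the cycle that
  -- avoids `x` and meets `a` only at its end survives.
  linked⇒star : ∀ {u} ws → All (λ w → w ≢ a × w ≢ x) (u ∷ ws) → Linked _~_ (u ∷ ws ∷ʳ a) →
                Star Remaining u a
  linked⇒star []       ((u≢a , u≢x) ∷ [])    (u~a ∷ [-])    = avoiding u≢a u≢x u~a ◅ ε
  linked⇒star (v ∷ ws) ((u≢a , u≢x) ∷ avoid) (u~v ∷ linked) =
    avoiding u≢a u≢x u~v ◅ linked⇒star ws avoid linked

  module _ (a~x : a ~ x) (x⇝a : Star Remaining x a)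
           (acyclic : ∀ {b ws} → 2 ℕ.≤ length ws → Unique (b ∷ ws) → ¬ Linked Remaining (b ∷ ws ∷ʳ b))
           where

    -- In a walk of `G`, every use of the deleted edge is replaced by `x⇝a` or its reverse.
    remaining-connected : ∀ u → Star Remaining u a
    remaining-connected u = Star._⋆ detour (connected u a)
      where
      detour : ∀ {u v} → u ~ v → Star Remaining u v
      detour u~v with remaining-or-deleted u~v
      ... | inj₁ Ruv                  = Ruv ◅ ε
      ... | inj₂ (inj₁ (refl , refl)) = Star.reverse remaining-sym x⇝a
      ... | inj₂ (inj₂ (refl , refl)) = x⇝a

    open BreadthFirst remaining? a remaining-connected

    private
      next : Fin n → Fin n
      next u = proj₁ (parent x u)

      next-root : next a ≡ x
      next-root = proj₁ (proj₂ (parent x a)) refl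

      next-parent : ∀ {u} → u ≢ a → Remaining u (next u) × distance (next u) ℕ.< distance u
      next-parent {u} = proj₂ (proj₂ (parent x u))

      -- The guards exclude the default value `next a ≡ x`, which is the deleted edge and not an
      -- edge to a parent.
      Tree : Rel (Fin n) 0ℓ
      Tree u v = u ≢ a × v ≡ next u ⊎ v ≢ a × u ≡ next v

      tree? : Decidable Tree
      tree? u v =
        (¬? (u Fin.≟ a) ×-dec (v Fin.≟ next u)) ⊎-dec (¬? (v Fin.≟ a) ×-dec (u Fin.≟ next v))

      tree⇒remaining : ∀ {u v} → Tree u v → Remaining u v
      tree⇒remaining (inj₁ (u≢a , refl)) = proj₁ (next-parent u≢a)
      tree⇒remaining (inj₂ (v≢a , refl)) = remaining-sym (proj₁ (next-parent v≢a))

      tree-connected : ∀ u → Star Tree u a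
      tree-connected u =
        <-rec (λ k → ∀ u → distance u ≡ k → Star Tree u a) step (distance u) u refl
        where
        step : ∀ k → (∀ {j} → j ℕ.< k → ∀ u → distance u ≡ j → Star Tree u a) →
               ∀ u → distance u ≡ k → Star Tree u a
        step k rec u refl with u Fin.≟ a
        ... | yes refl = ε
        ... | no u≢a   = inj₁ (u≢a , refl) ◅ rec (proj₂ (next-parent u≢a)) (next u) refl

      -- A remaining edge outside the tree would close a tree path to a cycle.
      remaining⇒tree : ∀ {u v} → Remaining u v → Tree u v
      remaining⇒tree {u} {v} Ruv = decidable-stable (tree? u v) λ ¬Tuv →
        let ws , p = star⇒path (tree-connected u ◅◅ Star.reverse Sum.swap (tree-connected v))
        in acyclic (long ¬Tuv p) (path-unique p) (path-linked tree⇒remaining p (remaining-sym Ruv))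
        where
        long : ∀ {ws} → ¬ Tree u v → Path Tree u v ws → 2 ℕ.≤ length ws
        long ¬Tuv []               = contradiction (proj₁ Ruv) (~-irrefl refl)
        long ¬Tuv ((Tuv , _) ∷ []) = contradiction Tuv ¬Tuv
        long ¬Tuv (_ ∷ _ ∷ _)      = s≤s (s≤s z≤n)

      -- The edge from `x` to its parent remains, while the edge to `a` is deleted. This prevents
      -- `next` from swapping `a` and `x`.
      next-x≢a : next x ≢ a
      next-x≢a nx≡a = proj₂ (proj₁ (next-parent x≢a)) (inj₂ (refl , nx≡a))
        where
        x≢a : x ≢ a
        x≢a refl = ~-irrefl refl a~x

    orientation : Orientation G
    orientation = record
      { next         = next
      ; ~-next       = ~-next
      ; ~⇒next       = ~⇒next
      ; next∘next≢id = next∘next≢id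
      }
      where
      ~-next : ∀ u → u ~ next u
      ~-next u with u Fin.≟ a
      ... | yes refl = subst (a ~_) (sym next-root) a~x
      ... | no  u≢a  = proj₁ (proj₁ (next-parent u≢a))

      ~⇒next : ∀ {u v} → u ~ v → v ≡ next u ⊎ u ≡ next v
      ~⇒next u~v with remaining-or-deleted u~v
      ... | inj₁ Ruv                  = Sum.map proj₂ proj₂ (remaining⇒tree Ruv)
      ... | inj₂ (inj₁ (refl , refl)) = inj₁ (sym next-root)
      ... | inj₂ (inj₂ (refl , refl)) = inj₂ (sym next-root)

      -- Both cases involving `a` reduce to `next x ≡ a`: for `u = a` because `next a = x`, and for
      -- `next u = a` because then `u = next (next u) = next a = x`. Elsewhere two parent steps
      -- strictly lower the distance.
      next∘next≢id : ∀ u → next (next u) ≢ u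
      next∘next≢id u nnu≡u with u Fin.≟ a | next u Fin.≟ a
      ... | yes refl | _        = next-x≢a (trans (cong next (sym next-root)) nnu≡u)
      ... | no _     | yes nu≡a = next-x≢a (subst (λ w → next w ≡ a)
        (trans (sym nnu≡u) (trans (cong next nu≡a) next-root)) nu≡a)
      ... | no u≢a   | no nu≢a  = ℕ.<-irrefl (cong distance nnu≡u)
        (ℕ.<-trans (proj₂ (next-parent nu≢a)) (proj₂ (next-parent u≢a)))

unicyclic⇒orientation : (G : Graph n) → Unicyclic G → Orientation G
unicyclic⇒orientation G (record { rest = []     ; long = () }     , _)
unicyclic⇒orientation G (record { rest = _ ∷ [] ; long = s≤s () } , _)
unicyclic⇒orientation G (C@record
  { base = a ; rest = x ∷ y ∷ ws
  ; distinct = (a≢x ∷ a≢y ∷ a≢ws) ∷ (x≢y ∷ x≢ws) ∷ _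
  ; linked = a~x ∷ x~y ∷ linked } , unique) = orientation a~x
    -- The edge from `x` to `y` survives because neither end is `a`; from `y` on, the cycle avoids
    -- `a` and `x` until it closes.
    ((x~y , [ a≢x ∘ sym ∘ proj₁ , a≢y ∘ sym ∘ proj₂ ]′)
      ◅ linked⇒star ws
          (All.zip (All.map ≡.≢-sym (a≢y ∷ a≢ws) , All.map ≡.≢-sym (x≢y ∷ x≢ws))) linked)
    acyclic
  where
  open Graph G using (Cycle; CycleEdge)
  open Deletion G a x
  -- By uniqueness, a cycle of remaining edges has the same edges as `C`, among them the deleted
  -- one.
  acyclic : ∀ {b ws} → 2 ℕ.≤ length ws → Unique (b ∷ ws) → ¬ Linked Remaining (b ∷ ws ∷ʳ b)
  acyclic {b} {ws} long distinct linked =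
    proj₂ (cycleEdge-linked G remaining-sym D linked
      (Equivalence.to (unique D a x) (inj₁ (consecutive-here G)))) (inj₁ (refl , refl))
    where
    D : Cycle
    D = record { base = b ; rest = ws ; long = long ; distinct = distinct
               ; linked = Linked.map proj₁ linked }

-- Marking three cycle vertices.

marks : Fin n → Fin n → Fin n → Fin n → ℕ
marks a x y u = indicator (u Fin.≟ a) ℕ.+ (indicator (u Fin.≟ x) ℕ.+ indicator (u Fin.≟ y))

sum-marks : (a x y : Fin n) → sum (marks a x y) ≡ 3
sum-marks a x y = trans (∑-distrib-+ (mark a) (λ u → mark x u ℕ.+ mark y u))
  (cong₂ ℕ._+_ (sum-indicator-≟ a) (trans (∑-distrib-+ (mark x) (mark y))
    (cong₂ ℕ._+_ (sum-indicator-≟ x) (sum-indicator-≟ y))))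
  where
  mark : Fin n → Fin n → ℕ
  mark v u = indicator (u Fin.≟ v)

marks≤ : {a x y : Fin n} (u : Fin n) {k : ℕ} → a ≢ x → a ≢ y → x ≢ y →
         (u ≡ a ⊎ u ≡ x ⊎ u ≡ y → 1 ℕ.≤ k) → marks a x y u ℕ.≤ k
marks≤ {a = a} {x} {y} u a≢x a≢y x≢y 1≤k with u Fin.≟ a | u Fin.≟ x | u Fin.≟ y
... | yes refl | yes refl | _        = contradiction refl a≢x
... | yes refl | no _     | yes refl = contradiction refl a≢y
... | no _     | yes refl | yes refl = contradiction refl x≢y
... | yes refl | no _     | no _     = 1≤k (inj₁ refl)
... | no _     | yes refl | no _     = 1≤k (inj₂ (inj₁ refl))
... | no _     | no _     | yes refl = 1≤k (inj₂ (inj₂ refl))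
... | no _     | no _     | no _     = z≤n

cycleVertex⇒1≤indegree : (G : Graph n) (O : Orientation G) (C : Graph.Cycle G) →
  ∀ {u} → CycleVertex G C u → 1 ℕ.≤ indegree (Orientation.next O) u
cycleVertex⇒1≤indegree G O C u∈ with two-cycleEdges G C u∈
... | v , w , v≢w , uv , uw =
  Orientation.1≤indegree O v≢w (cycleEdge⇒~ G C uv) (cycleEdge⇒~ G C uw)

-- `c` reserves one unit of in-degree at three cycle vertices; the other `n - 3` units can then be
-- moved freely in the lower bound.
three-marks : (G : Graph n) (O : Orientation G) → Graph.Cycle G →
  Σ[ c ∈ (Fin n → ℕ) ]
    (∀ u → c u ℕ.≤ 1) × (∀ u → c u ℕ.≤ indegree (Orientation.next O) u) × sum c ≡ 3
three-marks G O record { rest = []     ; long = () }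
three-marks G O record { rest = _ ∷ [] ; long = s≤s () }
three-marks G O C@record { base = a ; rest = x ∷ y ∷ ws
                         ; distinct = (a≢x ∷ a≢y ∷ _) ∷ (x≢y ∷ _) ∷ _ } =
    marks a x y
  , (λ u → marks≤ u a≢x a≢y x≢y (λ _ → s≤s z≤n))
  , (λ u → marks≤ u a≢x a≢y x≢y (cycleVertex⇒1≤indegree G O C ∘ vertex))
  , sum-marks a x y
  where
  vertex : ∀ {u} → u ≡ a ⊎ u ≡ x ⊎ u ≡ y → CycleVertex G C u
  vertex (inj₁ refl)        = here refl
  vertex (inj₂ (inj₁ refl)) = there (here refl)
  vertex (inj₂ (inj₂ refl)) = there (there (here refl))

-- A criterion for unicyclicity.

-- In a connected relation with at most two neighbours per vertex, every
-- cycle uses both neighbours of each of its vertices, hence all edges.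

module _ (G : Graph n) where
  open Graph G

  module _ {K : Rel (Fin n) 0ℓ} (K-sym : Symmetric K)
           (two : ∀ u → ∃₂ λ p q → ∀ {w} → K u w → w ≡ p ⊎ w ≡ q)
           (root : Fin n) (toRoot : ∀ {u v} → K u v → Star K u root)
           (inside : ∀ D {u v} → CycleEdge D u v → K u v) where

    cycleEdge-complete : ∀ D {u v} → K u v → CycleEdge D u v
    cycleEdge-complete D {u} Kuv = at-vertex (along base⇝u (here refl)) Kuv
      where
      at-vertex : ∀ {u w} → CycleVertex G D u → K u w → CycleEdge D u w
      at-vertex {u} u∈ Kuw with two u | two-cycleEdges G D u∈
      ... | p , q , pq | v , v′ , v≢v′ , uv , uv′
        with pq Kuw | pq (inside D uv) | pq (inside D uv′)
      ... | _         | inj₁ refl | inj₁ refl = contradiction refl v≢v′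
      ... | _         | inj₂ refl | inj₂ refl = contradiction refl v≢v′
      ... | inj₁ refl | inj₁ refl | inj₂ _    = uv
      ... | inj₁ refl | inj₂ _    | inj₁ refl = uv′
      ... | inj₂ refl | inj₁ _    | inj₂ refl = uv′
      ... | inj₂ refl | inj₂ refl | inj₁ _    = uv

      along : ∀ {u w} → Star K u w → CycleVertex G D u → CycleVertex G D w
      along ε           u∈ = u∈
      along (Kuv ◅ v⇝w) u∈ =
        along v⇝w (cycleEdge⇒vertex G D (cycleEdge-sym G D (at-vertex u∈ Kuv)))

      base⇝u : Star K (Cycle.base D) u
      base⇝u with two-cycleEdges G D (here refl)
      ... | _ , _ , _ , bv , _ = toRoot (inside D bv) ◅◅ Star.reverse K-sym (toRoot Kuv)

    -- By `inside` and `cycleEdge-complete`, the edge set of every cycle is exactly `K`.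
    unicyclic : Cycle → Unicyclic G
    unicyclic C = C , λ D u v →
      mk⇔ (cycleEdge-complete D ∘ inside C) (cycleEdge-complete C ∘ inside D)

-- Graphs given by a successor map.

module FunctionalGraph (next : Fin n → Fin n) (next≢id : ∀ u → next u ≢ u)
                       (next∘next≢id : ∀ u → next (next u) ≢ u)
                       (root : Fin n) (toRoot : ∀ u → Star (λ v w → w ≡ next v) u root) where

  graph : Graph n
  graph = record
    { _~_       = λ u v → v ≡ next u ⊎ u ≡ next v
    ; _~?_      = λ u v → (v Fin.≟ next u) ⊎-dec (u Fin.≟ next v)
    ; ~-sym     = Sum.swap
    ; ~-irrefl  = λ { refl → [ next≢id _ ∘ sym , next≢id _ ∘ sym ]′ }
    ; connected = λ u v → Star.map inj₁ (toRoot u) ◅◅ Star.reverse Sum.swap (Star.map inj₁ (toRoot v))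
    ; hasEdge   = root , next root , inj₁ refl
    }

  -- With an orientation by construction, the index of an extremal graph is read off the in-degrees
  -- of `next`.
  graph-orientation : Orientation graph
  graph-orientation = record
    { next = next ; ~-next = λ _ → inj₁ refl ; ~⇒next = id ; next∘next≢id = next∘next≢id }

-- Lower extremal graph: a triangle with leaves at one corner.

module PendantTriangle (k : ℕ) where

  -- The triangle runs 0, 2, 1, 0 and each leaf points to 0. `prev` inverts `next` on the triangle
  -- and takes the default `0F` on leaves.
  next prev : Fin (3 ℕ.+ k) → Fin (3 ℕ.+ k)
  next 0F                  = 2F
  next 1F                  = 0F
  next 2F                  = 1F
  next (suc (suc (suc _))) = 0F
  prev 0F                  = 1F
  prev 1F                  = 2F
  prev 2F                  = 0F
  prev (suc (suc (suc _))) = 0F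

  next≢id : ∀ u → next u ≢ u
  next≢id 0F                  ()
  next≢id 1F                  ()
  next≢id 2F                  ()
  next≢id (suc (suc (suc _))) ()

  next∘next≢id : ∀ u → next (next u) ≢ u
  next∘next≢id 0F                  ()
  next∘next≢id 1F                  ()
  next∘next≢id 2F                  ()
  next∘next≢id (suc (suc (suc _))) ()

  toRoot : ∀ u → Star (λ v w → w ≡ next v) u 0F
  toRoot 0F                  = ε
  toRoot 1F                  = refl ◅ ε
  toRoot 2F                  = refl ◅ refl ◅ ε
  toRoot (suc (suc (suc _))) = refl ◅ ε

  open FunctionalGraph next next≢id next∘next≢id 0F toRoot public
  open Graph graph

  data Core : Fin (3 ℕ.+ k) → Set where
    core₀ : Core 0F
    core₁ : Core 1F
    core₂ : Core 2F

  -- Vertex `0F` has `2 + k` neighbours in `graph`; restricting to the triangle leaves at most two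
  -- per vertex, as the criterion requires.
  CoreEdge : Rel (Fin (3 ℕ.+ k)) 0ℓ
  CoreEdge u v = u ~ v × Core u × Core v

  core-neighbours : ∀ u → ∃₂ λ p q → ∀ {w} → CoreEdge u w → w ≡ p ⊎ w ≡ q
  core-neighbours u = next u , prev u , λ where
    (inj₁ w≡next , _ , _)     → inj₁ w≡next
    (inj₂ refl , _ , core₀)   → inj₂ refl
    (inj₂ refl , _ , core₁)   → inj₂ refl
    (inj₂ refl , _ , core₂)   → inj₂ refl

  core-toRoot : ∀ {u v} → CoreEdge u v → Star CoreEdge u 0F
  core-toRoot (_ , core₀ , _) = ε
  core-toRoot (_ , core₁ , _) = (inj₁ refl , core₁ , core₀) ◅ ε
  core-toRoot (_ , core₂ , _) = (inj₂ refl , core₂ , core₀) ◅ ε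

  leaf-neighbour : ∀ i {w} → suc (suc (suc i)) ~ w → w ≡ 0F
  leaf-neighbour i (inj₁ w≡0) = w≡0
  leaf-neighbour i {0F}                  (inj₂ ())
  leaf-neighbour i {1F}                  (inj₂ ())
  leaf-neighbour i {2F}                  (inj₂ ())
  leaf-neighbour i {suc (suc (suc _))}   (inj₂ ())

  cycleVertex-core : ∀ D {u} → CycleVertex graph D u → Core u
  cycleVertex-core D {0F}                _  = core₀
  cycleVertex-core D {1F}                _  = core₁
  cycleVertex-core D {2F}                _  = core₂
  cycleVertex-core D {suc (suc (suc i))} u∈ with two-cycleEdges graph D u∈
  ... | v , w , v≢w , uv , uw = contradiction
    (trans (leaf-neighbour i (cycleEdge⇒~ graph D uv))
      (sym (leaf-neighbour i (cycleEdge⇒~ graph D uw)))) v≢w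

  graph-unicyclic : Unicyclic graph
  graph-unicyclic = unicyclic graph (λ (u~v , u∈ , v∈) → ~-sym u~v , v∈ , u∈)
    core-neighbours 0F core-toRoot
    (λ D uv → cycleEdge⇒~ graph D uv
            , cycleVertex-core D (cycleEdge⇒vertex graph D uv)
            , cycleVertex-core D (cycleEdge⇒vertex graph D (cycleEdge-sym graph D uv)))
    record
      { base     = 0F
      ; rest     = 1F ∷ 2F ∷ []
      ; long     = s≤s (s≤s z≤n)
      ; distinct = ((λ ()) ∷ (λ ()) ∷ []) ∷ ((λ ()) ∷ []) ∷ [] ∷ []
      ; linked   = inj₂ refl ∷ inj₂ refl ∷ inj₂ refl ∷ [-]
      }

  indegree₀ : indegree next 0F ≡ 1 ℕ.+ k
  indegree₀ = cong suc (sum-1 k)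

  indegree₁ : indegree next 1F ≡ 1
  indegree₁ = cong suc (sum-0 k)

  indegree₂ : indegree next 2F ≡ 1
  indegree₂ = cong suc (sum-0 k)

  indegree-leaf : ∀ i → indegree next (suc (suc (suc i))) ≡ 0
  indegree-leaf _ = sum-0 k

-- Upper extremal graph: the cycle.

linked-tabulate : ∀ {R : Rel A r} {n} (g : Fin (suc n) → A) {z} →
  (∀ i → R (g (inject₁ i)) (g (suc i))) → R (g (fromℕ n)) z → Linked R (List.tabulate g ∷ʳ z)
linked-tabulate {n = zero}  g step last = last ∷ [-]
linked-tabulate {n = suc n} g step last = step zero ∷ linked-tabulate (g ∘ suc) (step ∘ suc) last

module CycleGraph (k : ℕ) where

  -- `next` subtracts 1 modulo `3 + k`, so that following it descends to `zero`; `prev` adds 1.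
  next prev : Fin (3 ℕ.+ k) → Fin (3 ℕ.+ k)
  next zero    = fromℕ (2 ℕ.+ k)
  next (suc i) = inject₁ i
  prev u with view u
  ... | ‵fromℕ     = zero
  ... | ‵inject₁ i = suc i

  next∘prev≡id : ∀ u → next (prev u) ≡ u
  next∘prev≡id u with view u
  ... | ‵fromℕ     = refl
  ... | ‵inject₁ i = refl

  next-injective : ∀ {u v} → next u ≡ next v → u ≡ v
  next-injective {zero}  {zero}  _  = refl
  next-injective {zero}  {suc j} eq = contradiction eq Fin.fromℕ≢inject₁
  next-injective {suc i} {zero}  eq = contradiction (sym eq) Fin.fromℕ≢inject₁
  next-injective {suc i} {suc j} eq = cong suc (Fin.inject₁-injective eq)

  ≡next⇒≡prev : ∀ {u v} → u ≡ next v → v ≡ prev u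
  ≡next⇒≡prev {u} u≡nv = next-injective (trans (sym u≡nv) (sym (next∘prev≡id u)))

  ≡prev⇒≡next : ∀ {u v} → v ≡ prev u → u ≡ next v
  ≡prev⇒≡next {u} refl = sym (next∘prev≡id u)

  next≢id : ∀ u → next u ≢ u
  next≢id (suc i) eq = ℕ.1+n≢n (sym (trans (sym (Fin.toℕ-inject₁ i)) (cong toℕ eq)))

  -- Having three vertices matters where `next` wraps round: two steps lead from 0 to `1 + k` and
  -- from 1 to `2 + k`. Otherwise the value drops by 2.
  next∘next≢id : ∀ u → next (next u) ≢ u
  next∘next≢id zero          ()
  next∘next≢id (suc zero)    ()
  next∘next≢id (suc (suc i)) eq = ℕ.m+1+n≢n 1 (sym (trans
    (sym (trans (Fin.toℕ-inject₁ (inject₁ i)) (Fin.toℕ-inject₁ i))) (cong toℕ eq)))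

  toRoot : ∀ u → Star (λ v w → w ≡ next v) u zero
  toRoot = <-weakInduction _ ε (λ _ → refl ◅_)

  open FunctionalGraph next next≢id next∘next≢id zero toRoot public
  open Graph graph

  graph-unicyclic : Unicyclic graph
  graph-unicyclic = unicyclic graph ~-sym (λ u → next u , prev u , Sum.map id ≡next⇒≡prev)
    zero (λ {u} _ → connected u zero) (cycleEdge⇒~ graph)
    record
      { base     = zero
      ; rest     = List.tabulate suc
      ; long     = s≤s (s≤s z≤n)
      ; distinct = allFin⁺ (3 ℕ.+ k)
      ; linked   = linked-tabulate id (λ _ → inj₂ refl) (inj₂ refl)
      }

  -- `next` is a bijection with inverse `prev`, so `prev u` is the only preimage of `u`.
  indegree≡1 : ∀ u → indegree next u ≡ 1
  indegree≡1 u = trans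
    (sum-cong-≗ (λ v → cong (λ b → if b then 1 else 0)
      (does-⇔ (mk⇔ ≡next⇒≡prev ≡prev⇒≡next) (u Fin.≟ next v) (v Fin.≟ prev u))))
    (sum-indicator-≟ (prev u))

-- Inequalities for concave sequences.

module ConcaveSequences {c ℓ₁ ℓ₂} (ℝ : RealNumbers c ℓ₁ ℓ₂) where
  open RealNumbers ℝ hiding (zero) renaming (refl to ≈-refl; sym to ≈-sym; trans to ≈-trans)
  open OrderProperties ℝ
  open Indices ℝ using (Ray→ℝ; Concave; _at_)
  open CommutativeRing commutativeRing using (semiring; +-monoid)
  open MultProperties +-monoid using (×-homo-+; ×-congʳ) renaming (_×_ to _·_)
  open SemiringMultProperties semiring using (×-assoc-*)
  open SumProperties +-commutativeMonoid
    using (sum-replicate) renaming (sum to ∑; ∑-distrib-+ to ∑-homo-+)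
  open CommutativeMonoidSolver +-commutativeMonoid
    using (solve; _⊕_; _⊜_) renaming (id to ∅)
  open HeytingProperties heytingCommutativeRing using (x-0≈x)
  open import Relation.Binary.Reasoning.Setoid setoid

  private
    variable
      x y z u v w : Carrier

  +-cancelʳ-≤ : ∀ z → x + z ≤ y + z → x ≤ y
  +-cancelʳ-≤ z x+z≤y+z y<x = x+z≤y+z (+-monoˡ-< z y<x)

  ≤-resp-≈ : x ≈ y → z ≈ w → x ≤ z → y ≤ w
  ≤-resp-≈ x≈y z≈w x≤z = ≤-respˡ-≈ x≈y (≤-respʳ-≈ z≈w x≤z)

  ≤-reflexive : x ≈ y → x ≤ y
  ≤-reflexive x≈y = ≤-respʳ-≈ x≈y ≤-refl

  ι*x≈n·x : ∀ n x → ι n * x ≈ n · x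
  ι*x≈n·x n x = ≈-trans (×-assoc-* n 1# x) (×-congʳ n (*-identityˡ x))

  ∑-mono-≤ : ∀ {n} {f g : Fin n → Carrier} → (∀ i → f i ≤ g i) → ∑ f ≤ ∑ g
  ∑-mono-≤ {zero}  f≤g = ≤-refl
  ∑-mono-≤ {suc n} f≤g = +-mono-≤ (f≤g zero) (∑-mono-≤ (f≤g ∘ suc))

  ∑-· : ∀ {n} (d : Fin n → ℕ) x → ∑ (λ i → d i · x) ≈ sum d · x
  ∑-· {zero}  d x = ≈-refl
  ∑-· {suc n} d x =
    ≈-trans (+-congˡ (∑-· (d ∘ suc) x)) (≈-sym (×-homo-+ x (d zero) (sum (d ∘ suc))))

  -- Second differences are at most 0, written without subtraction.
  ConcaveSequence : (ℕ → Carrier) → Set ℓ₂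
  ConcaveSequence F = ∀ k → F (2 ℕ.+ k) + F k ≤ F (1 ℕ.+ k) + F (1 ℕ.+ k)

  half-exists : Σ[ h ∈ Carrier ] (h + h ≈ 1#)
  half-exists with #⇒invertible (Equivalence.from #⇔<⊎> (inj₂ 0<2))
    where
    0<2 : 0# < 1# + 1#
    0<2 = <-trans 0<1 (<-respˡ-≈ (+-identityˡ 1#) (+-monoˡ-< 1# 0<1))
  ... | h , h*[2-0]≈1 , _ = h , (begin
    h + h                ≈⟨ +-cong (*-identityʳ h) (*-identityʳ h) ⟨
    h * 1# + h * 1#      ≈⟨ distribˡ h 1# 1# ⟨
    h * (1# + 1#)        ≈⟨ *-congˡ (x-0≈x (1# + 1#)) ⟨
    h * (1# + 1# - 0#)   ≈⟨ h*[2-0]≈1 ⟩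
    1#                   ∎)

  half : Carrier
  half = proj₁ half-exists

  half+half≈1 : half + half ≈ 1#
  half+half≈1 = proj₂ half-exists

  0≤half : 0# ≤ half
  0≤half half<0 = <-asym 0<1 (<-respˡ-≈ half+half≈1
    (<-trans (<-respʳ-≈ (+-identityˡ half) (+-monoˡ-< half half<0)) half<0))

  half≤1 : half ≤ 1#
  half≤1 = ≤-resp-≈ (+-identityˡ half) half+half≈1 (+-monoˡ-≤ half 0≤half)

  1-half≈half : 1# - half ≈ half
  1-half≈half = begin
    1# - half              ≈⟨ +-congʳ half+half≈1 ⟨
    half + half - half     ≈⟨ +-assoc half half (- half) ⟩
    half + (half - half)   ≈⟨ +-congˡ (-‿inverseʳ half) ⟩
    half + 0#              ≈⟨ +-identityʳ half ⟩
    half                   ∎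

  half*x+half*x≈x : ∀ x → half * x + half * x ≈ x
  half*x+half*x≈x x = begin
    half * x + half * x   ≈⟨ distribʳ x half half ⟨
    (half + half) * x     ≈⟨ *-congʳ half+half≈1 ⟩
    1# * x                ≈⟨ *-identityˡ x ⟩
    x                     ∎

  midpoint : ∀ x y → half * x + (1# - half) * y ≈ half * (x + y)
  midpoint x y = ≈-trans (+-congˡ (*-congʳ 1-half≈half)) (≈-sym (distribˡ half x y))

  -- Concavity with `t = half` is applied between `3 + k` and `1 + k`, whose midpoint is `2 + k`;
  -- adding the inequality to itself clears the factor `half`.
  concave⇒concaveSequence : (f : Ray→ℝ) → Concave f → ConcaveSequence (λ k → f at suc k)
  concave⇒concaveSequence f concave k =
    ≤-respˡ-≈ (half*x+half*x≈x (f at (3 ℕ.+ k) + f at (1 ℕ.+ k))) (+-mono-≤ below below)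
    where
    m : Carrier
    m = ι (2 ℕ.+ k)
    abscissa : half * ι (3 ℕ.+ k) + (1# - half) * ι (1 ℕ.+ k) ≈ m
    abscissa = begin
      half * ι (3 ℕ.+ k) + (1# - half) * ι (1 ℕ.+ k)  ≈⟨ midpoint (ι (3 ℕ.+ k)) (ι (1 ℕ.+ k)) ⟩
      half * (1# + m + ι (1 ℕ.+ k))
        ≈⟨ *-congˡ (solve 2 (λ a b → (a ⊕ (a ⊕ b)) ⊕ b ⊜ (a ⊕ b) ⊕ (a ⊕ b)) ≈-refl 1# (ι (1 ℕ.+ k))) ⟩
      half * (m + m)                                  ≈⟨ distribˡ half m m ⟩
      half * m + half * m                             ≈⟨ half*x+half*x≈x m ⟩
      m                                               ∎
    below : half * (f at (3 ℕ.+ k) + f at (1 ℕ.+ k)) ≤ f at (2 ℕ.+ k)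
    below = ≤-resp-≈ (midpoint (f at (3 ℕ.+ k)) (f at (1 ℕ.+ k))) (Func.cong f abscissa)
      (concave (ι (3 ℕ.+ k) , 1≤ι (3 ℕ.+ k)) (ι (1 ℕ.+ k) , 1≤ι (1 ℕ.+ k)) half 0≤half half≤1)

  -- In terms of differences, `x - v ≤ y - u` and `v - z ≤ u - w` add up to `x - z ≤ y - w`.
  telescope : x + u ≤ v + y → v + w ≤ z + u → x + w ≤ z + y
  telescope {x} {u} {v} {y} {w} {z} p q = +-cancelʳ-≤ (u + v) (≤-resp-≈
    (solve 4 (λ x u v w → (x ⊕ u) ⊕ (v ⊕ w) ⊜ (x ⊕ w) ⊕ (u ⊕ v)) ≈-refl x u v w)
    (solve 4 (λ v y z u → (v ⊕ y) ⊕ (z ⊕ u) ⊜ (z ⊕ y) ⊕ (u ⊕ v)) ≈-refl v y z u)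
    (+-mono-≤ p q))

  -- The increment at `k + i` is compared with that at `i`; each induction step adds one instance of
  -- concavity.
  increments-decrease : ∀ F → ConcaveSequence F → ∀ k i →
                        F (suc k ℕ.+ i) + F i ≤ F (suc i) + F (k ℕ.+ i)
  increments-decrease F concave zero    i = ≤-refl
  increments-decrease F concave (suc k) i =
    telescope (concave (k ℕ.+ i)) (increments-decrease F concave k i)

  -- `F (j + k) - F k` and `F j - F 0` are sums of `j` increments, compared one by one. Gathering
  -- `j` and `k` units at one vertex thus never raises the sum of `F`.
  exchange : ∀ F → ConcaveSequence F → ∀ j k → F (j ℕ.+ k) + F 0 ≤ F k + F j
  exchange F concave zero    k = ≤-refl
  exchange F concave (suc j) k = telescope (≤-respʳ-≈ (+-comm _ _) increment) (exchange F concave j k)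
    where
    increment : F (suc (j ℕ.+ k)) + F j ≤ F (suc j) + F (j ℕ.+ k)
    increment = subst (λ m → F (suc m) + F j ≤ F (suc j) + F m)
      (ℕ.+-comm k j) (increments-decrease F concave k j)

  module _ (F : ℕ → Carrier) (concave : ConcaveSequence F) where

    -- By `exchange` with `j = 1`, each increment is at most `F 1 - F 0`, the slope of the chord
    -- through 0 and 1.
    below-chord : ∀ k → F k + k · F 0 ≤ F 0 + k · F 1
    below-chord zero    = ≤-refl
    below-chord (suc k) = +-cancelʳ-≤ (F k) (≤-resp-≈
      (solve 4 (λ a b c d → (a ⊕ b) ⊕ (c ⊕ d) ⊜ (a ⊕ (b ⊕ d)) ⊕ c) ≈-refl
        (F (suc k)) (F 0) (F k) (k · F 0))
      (solve 4 (λ a b c d → (b ⊕ a) ⊕ (c ⊕ d) ⊜ (c ⊕ (a ⊕ d)) ⊕ b) ≈-refl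
        (F 1) (F k) (F 0) (k · F 1))
      (+-mono-≤ (exchange F concave 1 k) (below-chord k)))

    ∑-point : ∀ {n} (d : Fin n → ℕ) →
              ∑ (λ i → F (d i) + d i · F 0) ≈ ∑ (F ∘ d) + sum d · F 0
    ∑-point d = ≈-trans (∑-homo-+ (F ∘ d) (λ i → d i · F 0)) (+-congˡ (∑-· d (F 0)))

    ∑-chord : ∀ {n} (d : Fin n → ℕ) →
              ∑ (λ i → F 0 + d i · F 1) ≈ n · F 0 + sum d · F 1
    ∑-chord {n} d =
      ≈-trans (∑-homo-+ (λ _ → F 0) (λ i → d i · F 1)) (+-cong (sum-replicate n) (∑-· d (F 1)))

    -- Summing the chord inequalities leaves `n · F 0` on both sides, and the coefficient of `F 1`
    -- is `n` because the `d i` add up to the number of terms.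
    ∑-upper : ∀ {n} (d : Fin n → ℕ) → sum d ≡ n → ∑ (F ∘ d) ≤ n · F 1
    ∑-upper {n} d sum≡n = +-cancelʳ-≤ (n · F 0) (≤-respʳ-≈ (+-comm (n · F 0) (n · F 1))
      (subst (λ s → ∑ (F ∘ d) + s · F 0 ≤ n · F 0 + s · F 1) sum≡n
        (≤-resp-≈ (∑-point d) (∑-chord d) (∑-mono-≤ (below-chord ∘ d)))))

    -- The chord meets `F` at 0 and 1, so there `below-chord` reverses; this bounds `∑ (F ∘ c)` from
    -- below for 0-1 sequences `c`.
    on-chord : ∀ {k} → k ℕ.≤ 1 → F 0 + k · F 1 ≤ F k + k · F 0
    on-chord z≤n       = ≤-refl
    on-chord (s≤s z≤n) =
      ≤-reflexive (solve 2 (λ a b → a ⊕ (b ⊕ ∅) ⊜ b ⊕ (a ⊕ ∅)) ≈-refl (F 0) (F 1))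

    -- Σᵢ (F (cᵢ + eᵢ) − F cᵢ) ≥ F (1 + Σᵢ eᵢ) − F 1, stated without subtraction.
    ∑-gather : ∀ {n} (c e : Fin n → ℕ) → (∀ i → c i ℕ.≤ 1) →
               ∑ (F ∘ c) + F (1 ℕ.+ sum e) ≤ ∑ (λ i → F (c i ℕ.+ e i)) + F 1
    ∑-gather {zero}  c e c≤1 = ≤-refl
    ∑-gather {suc n} c e c≤1 = +-cancelʳ-≤ (F (1 ℕ.+ s)) (≤-resp-≈
      (solve 4 (λ a b c d → (a ⊕ b) ⊕ (c ⊕ d) ⊜ ((b ⊕ c) ⊕ a) ⊕ d) ≈-refl
        (F (1 ℕ.+ (e zero ℕ.+ s))) (F (c zero)) (∑ (F ∘ c ∘ suc)) (F (1 ℕ.+ s)))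
      (solve 4 (λ a b c d → (a ⊕ b) ⊕ (c ⊕ d) ⊜ ((b ⊕ c) ⊕ d) ⊕ a) ≈-refl
        (F (1 ℕ.+ s)) (F (c zero ℕ.+ e zero)) (∑ (λ i → F (c (suc i) ℕ.+ e (suc i)))) (F 1))
      (+-mono-≤ (exchange₁ (c≤1 zero)) (∑-gather (c ∘ suc) (e ∘ suc) (c≤1 ∘ suc))))
      where
      s : ℕ
      s = sum (e ∘ suc)
      -- The `e zero` units move to the gathering place, which holds `1 + s`. For `b = 1` the
      -- exchange is applied to the shifted sequence `F ∘ suc`.
      exchange₁ : ∀ {b} → b ℕ.≤ 1 →
        F (1 ℕ.+ (e zero ℕ.+ s)) + F b ≤ F (1 ℕ.+ s) + F (b ℕ.+ e zero)
      exchange₁ z≤n       = subst (λ m → F m + F 0 ≤ F (1 ℕ.+ s) + F (e zero))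
        (ℕ.+-suc (e zero) s) (exchange F concave (e zero) (suc s))
      exchange₁ (s≤s z≤n) = exchange (F ∘ suc) (concave ∘ suc) (e zero) s

    -- `chord` bounds `∑ (F ∘ c)` below by `3 · F 1 + m · F 0`, and `gather` adds `F (1 + m) - F 1`,
    -- which turns one of the three `F 1` into `F (1 + m)`.
    ∑-lower : ∀ {m} (c e : Fin (3 ℕ.+ m) → ℕ) → (∀ i → c i ℕ.≤ 1) → sum c ≡ 3 → sum e ≡ m →
              F (1 ℕ.+ m) + 2 · F 1 + m · F 0 ≤ ∑ (λ i → F (c i ℕ.+ e i))
    ∑-lower {m} c e c≤1 sum-c≡3 sum-e≡m = +-cancelʳ-≤ (∑ (F ∘ c) + 3 · F 0 + F 1) (≤-resp-≈
      (solve 6 (λ a b c d e f → (a ⊕ b) ⊕ ((c ⊕ (c ⊕ (c ⊕ d))) ⊕ (e ⊕ f))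
          ⊜ ((b ⊕ f) ⊕ d) ⊕ ((a ⊕ (c ⊕ (c ⊕ (c ⊕ ∅)))) ⊕ e)) ≈-refl
        (∑ (F ∘ c)) (F (1 ℕ.+ m)) (F 0) (m · F 0) (F 1) (2 · F 1))
      (solve 4 (λ a b c d → (a ⊕ b) ⊕ (c ⊕ d) ⊜ a ⊕ ((c ⊕ d) ⊕ b)) ≈-refl
        (∑ (λ i → F (c i ℕ.+ e i))) (F 1) (∑ (F ∘ c)) (3 · F 0))
      (+-mono-≤ gather chord))
      where
      gather : ∑ (F ∘ c) + F (1 ℕ.+ m) ≤ ∑ (λ i → F (c i ℕ.+ e i)) + F 1
      gather = subst (λ s → ∑ (F ∘ c) + F (1 ℕ.+ s) ≤ ∑ (λ i → F (c i ℕ.+ e i)) + F 1)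
        sum-e≡m (∑-gather c e c≤1)
      chord : (3 ℕ.+ m) · F 0 + 3 · F 1 ≤ ∑ (F ∘ c) + 3 · F 0
      chord = subst (λ s → (3 ℕ.+ m) · F 0 + s · F 1 ≤ ∑ (F ∘ c) + s · F 0) sum-c≡3
        (≤-resp-≈ (∑-chord c) (∑-point c) (∑-mono-≤ (on-chord ∘ c≤1)))

-- Bounds and extremal values of the index.

module IndexBounds {c ℓ₁ ℓ₂} (ℝ : RealNumbers c ℓ₁ ℓ₂) where
  open RealNumbers ℝ hiding (zero) renaming (refl to ≈-refl; sym to ≈-sym; trans to ≈-trans)
  open Indices ℝ
  open ConcaveSequences ℝ
  open CommutativeRing commutativeRing using (+-monoid)
  open MultProperties +-monoid using () renaming (_×_ to _·_)
  open SumProperties +-commutativeMonoid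
    using (sum-cong-≋; sum-replicate) renaming (sum to ∑)
  open import Relation.Binary.Reasoning.Setoid setoid

  module _ (f : Ray→ℝ) where

    F : ℕ → Carrier
    F k = f at suc k

    F-cong : ∀ {j k} → j ≡ k → F j ≈ F k
    F-cong refl = ≈-refl

    -- The nonzeroness instance is irrelevant, so once `j` is `suc k` both sides are the same value.
    at-suc : ∀ {j k} .{{_ : NonZero j}} → j ≡ suc k → f at j ≈ F k
    at-suc refl = ≈-refl

    I≈∑indegree : ∀ {n} (G : Graph n) (O : Orientation G) →
                  I f G ≈ ∑ (F ∘ indegree (Orientation.next O))
    I≈∑indegree G O = sum-cong-≋ λ u →
      at-suc {{Graph.degree-nonZero G u}} (Orientation.degree≡1+indegree O u)

    I-upper : ∀ {n} (G : Graph n) → Unicyclic G → Concave f → I f G ≤ ι n * f at 2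
    I-upper {n} G uni concave = ≤-resp-≈ (≈-sym (I≈∑indegree G O)) (≈-sym (ι*x≈n·x n (F 1)))
      (∑-upper F (concave⇒concaveSequence f concave) (indegree next) (sum-indegree next))
      where
      O : Orientation G
      O = unicyclic⇒orientation G uni
      open Orientation O

    I-lower : ∀ {m} (G : Graph (3 ℕ.+ m)) → Unicyclic G → Concave f →
              f at (2 ℕ.+ m) + ι 2 * f at 2 + ι m * f at 1 ≤ I f G
    I-lower {m} G uni@(C , _) concave with unicyclic⇒orientation G uni
    ... | O with three-marks G O C
    ... | c , c≤1 , c≤indegree , sum-c = ≤-resp-≈
      (+-cong (+-congˡ (≈-sym (ι*x≈n·x 2 (F 1)))) (≈-sym (ι*x≈n·x m (F 0))))
      (≈-trans (sum-cong-≋ (λ u → F-cong (ℕ.m+[n∸m]≡n (c≤indegree u)))) (≈-sym (I≈∑indegree G O)))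
      (∑-lower F (concave⇒concaveSequence f concave) c e c≤1 sum-c (ℕ.+-cancelˡ-≡ 3 (sum e) m sum-e))
      where
      open Orientation O
      e : Fin (3 ℕ.+ m) → ℕ
      -- The truncated subtraction is exact because `c u ≤ indegree next u`.
      e u = indegree next u ∸ c u
      sum-e : 3 ℕ.+ sum e ≡ 3 ℕ.+ m
      sum-e = trans (cong (ℕ._+ sum e) (sym sum-c)) (trans (sym (∑-distrib-+ c e))
        (trans (sum-cong-≗ (λ u → ℕ.m+[n∸m]≡n (c≤indegree u))) (sum-indegree next)))

    I-pendantTriangle : ∀ k → let open PendantTriangle k in
      I f graph ≈ f at (2 ℕ.+ k) + ι 2 * f at 2 + ι k * f at 1
    I-pendantTriangle k = begin
      I f graph
        ≈⟨ I≈∑indegree graph graph-orientation ⟩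
      ∑ (F ∘ indegree next)
        ≈⟨ +-cong (F-cong indegree₀) (+-cong (F-cong indegree₁) (+-cong (F-cong indegree₂)
             (≈-trans (sum-cong-≋ (F-cong ∘ indegree-leaf)) (sum-replicate k)))) ⟩
      F (1 ℕ.+ k) + (F 1 + (F 1 + k · F 0))
        ≈⟨ solve 3 (λ a b c → a ⊕ (b ⊕ (b ⊕ c)) ⊜ (a ⊕ (b ⊕ (b ⊕ ∅))) ⊕ c) ≈-refl
             (F (1 ℕ.+ k)) (F 1) (k · F 0) ⟩
      F (1 ℕ.+ k) + 2 · F 1 + k · F 0
        ≈⟨ +-cong (+-congˡ (ι*x≈n·x 2 (F 1))) (ι*x≈n·x k (F 0)) ⟨
      f at (2 ℕ.+ k) + ι 2 * f at 2 + ι k * f at 1 ∎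
      where
      open PendantTriangle k
      open CommutativeMonoidSolver +-commutativeMonoid
        using (solve; _⊕_; _⊜_) renaming (id to ∅)

    I-cycleGraph : ∀ k → I f (CycleGraph.graph k) ≈ ι (3 ℕ.+ k) * f at 2
    I-cycleGraph k = begin
      I f graph               ≈⟨ I≈∑indegree graph graph-orientation ⟩
      ∑ (F ∘ indegree next)   ≈⟨ sum-cong-≋ (F-cong ∘ indegree≡1) ⟩
      ∑ {3 ℕ.+ k} (λ _ → F 1) ≈⟨ sum-replicate (3 ℕ.+ k) ⟩
      (3 ℕ.+ k) · F 1         ≈⟨ ι*x≈n·x (3 ℕ.+ k) (F 1) ⟨
      ι (3 ℕ.+ k) * f at 2    ∎
      where open CycleGraph k

theorem3p5 :
    ∀ {c ℓ₁ ℓ₂} (ℝ : RealNumbers c ℓ₁ ℓ₂) →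
    let open RealNumbers ℝ
        open Indices ℝ
    in
    (n : ℕ) (4≤n : 4 ℕ.≤ n) (f : Ray→ℝ) → Concave f →
    let lower = _at_ f (n ∸ 1) {{4≤n⇒n∸1-nonZero 4≤n}} + ι 2 * f at 2 + ι (n ∸ 3) * f at 1
        upper = ι n * f at 2
    in
    ((G : Graph n) → Unicyclic G → (lower ≤ I f G) × (I f G ≤ upper))
    × (Σ[ G ∈ Graph n ] (Unicyclic G × (I f G ≈ lower)))
    × (Σ[ G ∈ Graph n ] (Unicyclic G × (I f G ≈ upper)))
-- With `n` written as `3 + k`, the differences `n ∸ 1` and `n ∸ 3` compute to `2 + k` and `k`.
theorem3p5 ℝ (suc (suc (suc k))) (s≤s (s≤s (s≤s _))) f concave =
    (λ G uni → I-lower f G uni concave , I-upper f G uni concave)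
  , (PendantTriangle.graph k , PendantTriangle.graph-unicyclic k , I-pendantTriangle f k)
  , (CycleGraph.graph k , CycleGraph.graph-unicyclic k , I-cycleGraph f k)
  where open IndexBounds ℝ
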